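{- The competitive ratio of the Move-All-Equally algorithm for $r$-uniform Online Min-Sum Set Cover against the dynamic optimum is $O(r^{3/2}\sqrt{n})$; that is, there is an absolute constant $C$ such that for all $n$ and $r$, Move-All-Equally is $C\,r^{3/2}\sqrt{n}$-competitive against the dynamic optimum.
   Context: Let $U$ be a set of $n$ elements; a permutation $\pi$ of $U$ gives each element $e$ a position $\pi[e]\in\{1,\dots,n\}$, and $\pi(S)=\min_{e\in S}\pi[e]$ for nonempty $S\subseteq U$. $d_{KT}(\pi,\sigma)$ is the number of pairs of elements ordered differently by $\pi,\sigma$. In $r$-uniform Online Min-Sum Set Cover, from an initial permutation $\pi_0$, request sets $S_1,\dots,S_m$ with $|S_t|=r$ arrive online; on arrival of $S_t$ an algorithm holding $\pi_{t-1}$ pays access cost $\pi_{t-1}(S_t)$ and then moves to $\pi_t$ paying $d_{KT}(\pi_{t-1},\pi_t)$. The dynamic optimum is $\mathrm{OPT}_{dyn}=\min\sum_{t=1}^m\big(\pi^*_t(S_t)+d_{KT}(\pi^*_{t-1},\pi^*_t)\big)$ over all sequences of permutations $\pi^*_1,\dots,\pi^*_m$, with $\pi^*_0=\pi_0$. An algorithm is $c$-competitive against the dynamic optimum if its cost is at most $c\cdot\mathrm{OPT}_{dyn}+\alpha$ for all initial permutations and sequences, with $\alpha$ independent of the sequence. Move-All-Equally: given current permutation $\pi$ and request $S$, let $k=\pi(S)$; the new permutation $\pi'$ places each $e\in S$ at $\pi'[e]=\pi[e]-(k-1)$ and the elements of $U\setminus S$ fill the remaining positions in their relative order in $\pi$.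 -}

module Defs where

open import Data.Nat using (ℕ; zero; suc; _+_; _⊓_; _<ᵇ_)
open import Data.Bool using (Bool; true; false; if_then_else_; not; _xor_)
open import Data.Fin using (Fin; _<?_)
open import Data.Fin.Subset using (Subset)
open import Data.Fin.Properties using (_≟_)
open import Data.Vec using (lookup)
open import Data.List using (List; []; _∷_; _++_; [_]; length; allFin; spanᵇ; foldr; map)
open import Data.Nat.ListAction using (sum)
open import Data.Product using (_,_)
open import Relation.Nullary using (does)

-- A permutation of U = Fin n is represented as an ordering: the list of
-- all elements, from position 1 to position n (each element exactly once,
-- enforced in the statement by  L ↭ allFin n).
Ordering : ℕ → Set
Ordering n = List (Fin n)

inS : ∀ {n} → Subset n → Fin n → Bool
inS S e = lookup S e

pos0 : ∀ {n} → Ordering n → Fin n → ℕ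
pos0 [] e = 0
pos0 (x ∷ xs) e = if does (x ≟ e) then 0 else suc (pos0 xs e)

pos : ∀ {n} → Ordering n → Fin n → ℕ
pos L e = suc (pos0 L e)

-- π(S) = min_{e ∈ S} π[e]   (initial value n is ≥ every position, so it
-- does not affect the minimum of a nonempty S)
access : ∀ {n} → Ordering n → Subset n → ℕ
access {n} L S = foldr (λ e acc → if inS S e then pos L e ⊓ acc else acc) n (allFin n)

dKT : ∀ {n} → Ordering n → Ordering n → ℕ
dKT {n} L M = sum (map (λ a → sum (map (λ b →
    if does (a <? b)
    then (if (pos L a <ᵇ pos L b) xor (pos M a <ᵇ pos M b) then 1 else 0)
    else 0) (allFin n))) (allFin n))

-- Move-All-Equally.  Split L = prefix ++ rest where prefix = the first k-1
-- elements (k = π(S)), none of which lies in S.  Walking through rest,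
-- an element of S stays at its offset in rest (i.e. moves from position p to
-- p-(k-1)); every other slot is filled, FIFO, by the non-S elements
-- (prefix first, then non-S elements of rest), preserving their relative order.
maeGo : ∀ {n} → Subset n → List (Fin n) → List (Fin n) → List (Fin n)
maeGo S q [] = q
maeGo S q (x ∷ xs) with inS S x
... | true = x ∷ maeGo S q xs
maeGo S [] (x ∷ xs) | false = x ∷ maeGo S [] xs
maeGo S (y ∷ q) (x ∷ xs) | false = y ∷ maeGo S (q ++ [ x ]) xs

mae : ∀ {n} → Ordering n → Subset n → Ordering n
mae L S with spanᵇ (λ e → not (inS S e)) L
... | (prefix , rest) = maeGo S prefix rest

maeCost : ∀ {n} → Ordering n → List (Subset n) → ℕ
maeCost L [] = 0
maeCost L (S ∷ Ss) = access L S + dKT L (mae L S) + maeCost (mae L S) Ss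

offCost : ∀ {n} → Ordering n → List (Subset n) → List (Ordering n) → ℕ
offCost L (S ∷ Ss) (P ∷ Ps) = access P S + dKT L P + offCost P Ss Ps
offCost L _ _ = 0

{-# OPTIONS --safe #-}

-- Fix s with s² r ≤ n < (s+1)² r and weight the element at (0-based) position j
-- of the optimum's ordering by 2s ∸ j.  The potential is the weighted sum of the
-- positions that Move-All-Equally gives to the elements.
--   * The weights are 1-Lipschitz in j, so a swap by the optimum raises the
--     potential by O(n).
--   * If k is the access cost of Move-All-Equally, then every requested element
--     advances by k-1 and every other element falls back by at most r, which raises
--     the potential by at most r (2s)² = O(n) in total.
--   * If the optimum accesses some requested element within its first s positions,
--     that element has weight ≥ s and the potential drops by s (k-1).  Otherwise the
--     optimum pays more than s, and s k ≤ n · (optimum's access cost) anyway.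
-- Hence s Σ k = O(n) OPT + const.  The moves cost only O(r k), and n/s = O(√(r n)).

module Submission where

open import Defs
open import Data.Bool using (Bool; true; false; if_then_else_; not; _xor_; _∧_)
open import Data.Nat using (ℕ; zero; suc; _+_; _*_; _∸_; _^_; _⊓_; _≤_; _<_; z≤n; s≤s; z<s; _<ᵇ_; >-nonZero)
open import Data.Nat.Properties hiding (_<?_)
open import Data.Nat.ListAction using (sum)
open import Data.Nat.ListAction.Properties using (sum-↭)
open import Data.Nat.Tactic.RingSolver using (solve-∀)
open import Data.Fin using (Fin; _<?_)
import Data.Fin as Fin
import Data.Fin.Properties as Fin
open import Data.Fin.Subset using (Subset; ∣_∣)
open import Data.Fin.Subset.Properties using (∣p∣≤n)
open import Data.List using (List; []; _∷_; _++_; [_]; length; allFin; spanᵇ; foldr; map)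
open import Data.List.Properties using (++-assoc; ++-identityʳ; map-tabulate; length-tabulate)
open import Data.List.Membership.Propositional using (_∈_)
open import Data.List.Membership.Propositional.Properties using (∈-allFin; ∈-++⁻)
open import Data.List.Relation.Unary.All as All using (All; []; _∷_)
open import Data.List.Relation.Unary.All.Properties using (++⁺)
open import Data.List.Relation.Unary.AllPairs using ([]; _∷_)
open import Data.List.Relation.Unary.Any using (here; there)
open import Data.List.Relation.Unary.Unique.Propositional using (Unique)
open import Data.List.Relation.Unary.Unique.Propositional.Properties using (allFin⁺)
open import Data.List.Relation.Binary.Permutation.Propositional
  using (_↭_; prep; ↭-sym; ↭-trans; ↭-reflexive; ↭⇒↭ₛ)
open import Data.List.Relation.Binary.Permutation.Propositional.Properties
  using (map⁺; ↭-length; ∈-resp-↭; shift)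
import Data.List.Relation.Binary.Permutation.Setoid.Properties as Permₛ
open import Data.Product using (∃-syntax; _×_; _,_; proj₁; proj₂)
open import Data.Sum using (inj₁; inj₂)
open import Data.Vec using ([]; _∷_)
open import Function using (_∘_; id)
open import Relation.Nullary using (does; yes; no; contradiction)
open import Relation.Binary.Definitions using (tri<; tri≈; tri>)
open import Relation.Binary.PropositionalEquality
  using (_≡_; _≢_; refl; sym; trans; cong; cong₂; subst; setoid)

private
  variable
    A B : Set
    n r : ℕ

-- Finite sums over lists.

∑ : List A → (A → ℕ) → ℕ
∑ xs f = sum (map f xs)

∑-mono-∈ : ∀ (xs : List A) {f g} → (∀ {x} → x ∈ xs → f x ≤ g x) → ∑ xs f ≤ ∑ xs g
∑-mono-∈ []       f≤g = z≤n
∑-mono-∈ (x ∷ xs) f≤g = +-mono-≤ (f≤g (here refl)) (∑-mono-∈ xs (f≤g ∘ there))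

∑-mono : ∀ (xs : List A) {f g} → (∀ x → f x ≤ g x) → ∑ xs f ≤ ∑ xs g
∑-mono xs f≤g = ∑-mono-∈ xs (λ {x} _ → f≤g x)

∑-cong-∈ : ∀ (xs : List A) {f g} → (∀ {x} → x ∈ xs → f x ≡ g x) → ∑ xs f ≡ ∑ xs g
∑-cong-∈ xs f≡g = ≤-antisym (∑-mono-∈ xs (≤-reflexive ∘ f≡g)) (∑-mono-∈ xs (≤-reflexive ∘ sym ∘ f≡g))

∑-+ : ∀ (xs : List A) f g → ∑ xs (λ x → f x + g x) ≡ ∑ xs f + ∑ xs g
∑-+ []       f g = refl
∑-+ (x ∷ xs) f g = trans (cong (f x + g x +_) (∑-+ xs f g)) (lemma (f x) (g x) _ _)
  where
  lemma : ∀ a b c d → a + b + (c + d) ≡ a + c + (b + d)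
  lemma = solve-∀

∑-*ˡ : ∀ c (xs : List A) f → ∑ xs (λ x → c * f x) ≡ c * ∑ xs f
∑-*ˡ c []       f = sym (*-zeroʳ c)
∑-*ˡ c (x ∷ xs) f = trans (cong (c * f x +_) (∑-*ˡ c xs f)) (sym (*-distribˡ-+ c (f x) _))

∑-zero : ∀ (xs : List A) → ∑ xs (λ _ → 0) ≡ 0
∑-zero []       = refl
∑-zero (x ∷ xs) = ∑-zero xs

∑-const : ∀ (xs : List A) c → ∑ xs (λ _ → c) ≡ length xs * c
∑-const []       c = refl
∑-const (x ∷ xs) c = cong (c +_) (∑-const xs c)

∑-swap : ∀ (xs : List A) (ys : List B) (f : A → B → ℕ) →
         ∑ xs (λ x → ∑ ys (f x)) ≡ ∑ ys (λ y → ∑ xs (λ x → f x y))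
∑-swap []       ys f = sym (∑-zero ys)
∑-swap (x ∷ xs) ys f = trans (cong (∑ ys (f x) +_) (∑-swap xs ys f)) (sym (∑-+ ys (f x) _))

∑-∈ : ∀ {xs : List A} f {x} → x ∈ xs → f x ≤ ∑ xs f
∑-∈ f (here refl)  = m≤m+n _ _
∑-∈ f (there x∈xs) = ≤-trans (∑-∈ f x∈xs) (m≤n+m _ _)

∑-↭ : ∀ {xs ys : List A} f → xs ↭ ys → ∑ xs f ≡ ∑ ys f
∑-↭ f xs↭ys = sum-↭ (map⁺ f xs↭ys)

⟦_⟧ : Bool → ℕ
⟦ b ⟧ = if b then 1 else 0

-- `dKT` counts a pair only in the order a < b, while the estimates below run over all ordered
-- pairs. This lemma passes between the two, in both directions, at the price of a factor 2.
∑-symmetrise : ∀ (xs : List A) (f g : A → A → ℕ) → (∀ a b → f a b ≤ g a b + g b a) →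
               ∑ xs (λ a → ∑ xs (f a)) ≤ 2 * ∑ xs (λ a → ∑ xs (g a))
∑-symmetrise xs f g f≤g = begin
  ∑ xs (λ a → ∑ xs (f a))                                          ≤⟨ ∑-mono xs (λ a → ∑-mono xs (f≤g a)) ⟩
  ∑ xs (λ a → ∑ xs (λ b → g a b + g b a))                          ≤⟨ ∑-mono xs (λ a → ≤-reflexive (∑-+ xs (g a) _)) ⟩
  ∑ xs (λ a → ∑ xs (g a) + ∑ xs (λ b → g b a))                     ≡⟨ ∑-+ xs _ _ ⟩
  ∑ xs (λ a → ∑ xs (g a)) + ∑ xs (λ a → ∑ xs (λ b → g b a))        ≡⟨ cong (∑ xs (λ a → ∑ xs (g a)) +_) (∑-swap xs xs (λ a b → g b a)) ⟩
  ∑ xs (λ a → ∑ xs (g a)) + ∑ xs (λ a → ∑ xs (g a))                ≡⟨ cong (∑ xs (λ a → ∑ xs (g a)) +_) (sym (+-identityʳ _)) ⟩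
  2 * ∑ xs (λ a → ∑ xs (g a))                                      ∎
  where open ≤-Reasoning

-- Positions in an ordering.

<ᵇ-true : ∀ {m k} → m < k → (m <ᵇ k) ≡ true
<ᵇ-true {zero}  z<s       = refl
<ᵇ-true {suc m} (s≤s m<k) = <ᵇ-true {m} m<k

<ᵇ-false : ∀ {m k} → k ≤ m → (m <ᵇ k) ≡ false
<ᵇ-false z≤n       = refl
<ᵇ-false (s≤s k≤m) = <ᵇ-false k≤m

pos0-self : ∀ (x : Fin n) xs → pos0 (x ∷ xs) x ≡ 0
pos0-self x xs with x Fin.≟ x
... | yes _   = refl
... | no  x≢x = contradiction refl x≢x

pos0-tail : ∀ {x e : Fin n} xs → x ≢ e → pos0 (x ∷ xs) e ≡ suc (pos0 xs e)
pos0-tail {x = x} {e} xs x≢e with x Fin.≟ e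
... | yes x≡e = contradiction x≡e x≢e
... | no  _   = refl

pos0-<-length : ∀ {L : Ordering n} {e} → e ∈ L → pos0 L e < length L
pos0-<-length {L = x ∷ L} {e} e∈L with x Fin.≟ e | e∈L
... | yes _   | _         = z<s
... | no  x≢e | here e≡x  = contradiction (sym e≡x) x≢e
... | no  _   | there e∈ = s≤s (pos0-<-length e∈)

pos0-injective : ∀ {L : Ordering n} {a b} → a ∈ L → pos0 L a ≡ pos0 L b → a ≡ b
pos0-injective {L = x ∷ L} {a} {b} a∈L eq with x Fin.≟ a | x Fin.≟ b | a∈L
... | yes x≡a | yes x≡b | _         = trans (sym x≡a) x≡b
... | no x≢a  | no  _   | here a≡x  = contradiction (sym a≡x) x≢a
... | no _    | no  _   | there a∈  = pos0-injective a∈ (suc-injective eq)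

before : Ordering n → Fin n → Fin n → Bool
before L a b = pos0 L a <ᵇ pos0 L b

-- Induction on `L`: the head counts once towards every element of the tail, and uniqueness keeps
-- the head from recurring there, so all tail positions shift by exactly one.
∑-before : ∀ {L : Ordering n} {e} → Unique L → e ∈ L → ∑ L (λ b → ⟦ before L b e ⟧) ≡ pos0 L e
∑-before {L = x ∷ L} {e} (x∉ ∷ uniq) e∈L with x Fin.≟ e | e∈L
... | yes refl | _       = cong₂ _+_ (cong ⟦_⟧ (<ᵇ-false {pos0 (x ∷ L) x} z≤n))
  (trans (∑-cong-∈ L {λ b → ⟦ pos0 (x ∷ L) b <ᵇ 0 ⟧} {λ _ → 0} (λ {b} _ → cong ⟦_⟧ (<ᵇ-false {pos0 (x ∷ L) b} z≤n))) (∑-zero L))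
... | no x≢e  | here e≡x = contradiction (sym e≡x) x≢e
... | no _    | there e∈ = cong₂ _+_
  (cong (λ p → ⟦ p <ᵇ suc (pos0 L e) ⟧) (pos0-self x L))
  (trans (∑-cong-∈ L (λ {b} b∈ → cong (λ p → ⟦ p <ᵇ suc (pos0 L e) ⟧) (pos0-tail L (All.lookup x∉ b∈))))
         (∑-before uniq e∈))

module _ {L : Ordering n} (perm : L ↭ allFin n) where

  unique : Unique L
  unique = Permₛ.Unique-resp-↭ (setoid (Fin n)) (↭⇒↭ₛ (↭-sym perm)) (allFin⁺ n)

  complete : ∀ e → e ∈ L
  complete e = ∈-resp-↭ (↭-sym perm) (∈-allFin e)

  pos0-<n : ∀ e → pos0 L e < n
  pos0-<n e = subst (pos0 L e <_) (trans (↭-length perm) (length-tabulate {n = n} id)) (pos0-<-length (complete e))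

  -- Written as a count over `allFin n`, the positions of an element in two orderings can be
  -- compared term by term.
  pos0-rank : ∀ e → pos0 L e ≡ ∑ (allFin n) (λ b → ⟦ before L b e ⟧)
  pos0-rank e = trans (sym (∑-before unique (complete e))) (∑-↭ _ perm)

  before-flip : ∀ {a b} → a ≢ b → before L a b ≡ not (before L b a)
  before-flip {a} {b} a≢b with <-cmp (pos0 L a) (pos0 L b)
  ... | tri< a<b _ _ = trans (<ᵇ-true a<b) (cong not (sym (<ᵇ-false (<⇒≤ a<b))))
  ... | tri≈ _ a≡b _ = contradiction (pos0-injective (complete a) a≡b) a≢b
  ... | tri> _ _ b<a = trans (<ᵇ-false (<⇒≤ b<a)) (cong not (sym (<ᵇ-true b<a)))

-- Sizes of requests, and disagreements between two orderings.

∑-allFin-suc : ∀ (f : Fin (suc n) → ℕ) → ∑ (allFin (suc n)) f ≡ f Fin.zero + ∑ (allFin n) (f ∘ Fin.suc)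
∑-allFin-suc {n} f = cong (λ xs → f Fin.zero + sum xs)
  (trans (map-tabulate Fin.suc f) (sym (map-tabulate id (f ∘ Fin.suc))))

∑-inS : ∀ (S : Subset n) → ∑ (allFin n) (λ e → ⟦ inS S e ⟧) ≡ ∣ S ∣
∑-inS []          = refl
∑-inS (true ∷ S)  = trans (∑-allFin-suc (λ e → ⟦ inS (true ∷ S) e ⟧)) (cong suc (∑-inS S))
∑-inS (false ∷ S) = trans (∑-allFin-suc (λ e → ⟦ inS (false ∷ S) e ⟧)) (∑-inS S)

nonempty : ∀ (S : Subset n) → 1 ≤ ∣ S ∣ → ∃[ e ] inS S e ≡ true
nonempty (true ∷ S)  _ = Fin.zero , refl
nonempty (false ∷ S) h with e , e∈S ← nonempty S h = Fin.suc e , e∈S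

disagree : Ordering n → Ordering n → Fin n → Fin n → ℕ
disagree L M a b = ⟦ before L a b xor before M a b ⟧

-- Exchanging two distinct elements negates both sides of the `xor`, so disagreement is symmetric;
-- on the diagonal it vanishes. Each pair in `dKT` is thus counted twice.
∑-disagree : ∀ {L M : Ordering n} → L ↭ allFin n → M ↭ allFin n →
             ∑ (allFin n) (λ a → ∑ (allFin n) (disagree L M a)) ≤ 2 * dKT L M
∑-disagree {n} {L} {M} pL pM = ∑-symmetrise (allFin n) (disagree L M) _ pointwise
  where
  flip-xor : ∀ {a b} → a ≢ b → disagree L M a b ≡ disagree L M b a
  flip-xor {a} {b} a≢b rewrite before-flip pL a≢b | before-flip pM a≢b
    with before L b a | before M b a
  ... | true  | true  = refl
  ... | true  | false = refl
  ... | false | true  = refl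
  ... | false | false = refl
  pointwise : ∀ a b → disagree L M a b ≤
    (if does (a <? b) then disagree L M a b else 0) + (if does (b <? a) then disagree L M b a else 0)
  pointwise a b with Fin.<-cmp a b
  ... | tri< a<b _ _ rewrite <ᵇ-true a<b = m≤m+n _ _
  ... | tri> _ a≢b b<a rewrite <ᵇ-true b<a = ≤-trans (≤-reflexive (flip-xor a≢b)) (m≤n+m _ _)
  ... | tri≈ _ refl _ rewrite <ᵇ-false {pos0 L a} ≤-refl | <ᵇ-false {pos0 M a} ≤-refl = z≤n

-- Whatever precedes `e` in `L` either precedes it in `M` too or is a disagreement.
pos0-≤-disagree : ∀ {L M : Ordering n} → L ↭ allFin n → M ↭ allFin n → ∀ e →
                  pos0 L e ≤ pos0 M e + ∑ (allFin n) (λ b → disagree L M b e)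
pos0-≤-disagree {n} {L} {M} pL pM e = begin
  pos0 L e                                                        ≡⟨ pos0-rank pL e ⟩
  ∑ (allFin n) (λ b → ⟦ before L b e ⟧)                           ≤⟨ ∑-mono (allFin n) (λ b → xor-≤ (before L b e) (before M b e)) ⟩
  ∑ (allFin n) (λ b → ⟦ before M b e ⟧ + disagree L M b e)        ≡⟨ ∑-+ (allFin n) _ _ ⟩
  ∑ (allFin n) (λ b → ⟦ before M b e ⟧) + ∑ (allFin n) (λ b → disagree L M b e)
                                                                  ≡⟨ cong (_+ ∑ (allFin n) (λ b → disagree L M b e)) (pos0-rank pM e) ⟨
  pos0 M e + ∑ (allFin n) (λ b → disagree L M b e)                ∎
  where
  open ≤-Reasoning
  xor-≤ : ∀ x y → ⟦ x ⟧ ≤ ⟦ y ⟧ + ⟦ x xor y ⟧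
  xor-≤ false y     = z≤n
  xor-≤ true  false = ≤-refl
  xor-≤ true  true  = ≤-refl

-- How Move-All-Equally rearranges an ordering.

true-false-elim : ∀ {b} → b ≡ true → b ≡ false → ∀ {X : Set} → X
true-false-elim refl ()

pos0-skip : ∀ (S : Subset n) {y a} ys → inS S y ≡ false → inS S a ≡ true → pos0 (y ∷ ys) a ≡ suc (pos0 ys a)
pos0-skip S {y} ys y∉S a∈S = pos0-tail {x = y} ys (λ { refl → true-false-elim a∈S y∉S })

pos0-++ : ∀ (S : Subset n) {a} q ys → All (λ x → inS S x ≡ false) q → inS S a ≡ true →
          pos0 (q ++ ys) a ≡ length q + pos0 ys a
pos0-++ S []      ys []         a∈S = refl
pos0-++ S (y ∷ q) ys (y∉S ∷ ns) a∈S =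
  trans (pos0-skip S {y} (q ++ ys) y∉S a∈S) (cong suc (pos0-++ S q ys ns a∈S))

-- Needed when a requested element leaves the middle of `q ++ x ∷ xs`: the relative order of two
-- other elements survives.
pos0-delete : ∀ {x a b : Fin n} q {ys} → x ≢ a → x ≢ b →
              pos0 (q ++ x ∷ ys) b < pos0 (q ++ x ∷ ys) a → pos0 (q ++ ys) b < pos0 (q ++ ys) a
pos0-delete [] {ys} x≢a x≢b lt rewrite pos0-tail ys x≢a | pos0-tail ys x≢b = ≤-pred lt
pos0-delete {a = a} {b} (y ∷ q) x≢a x≢b lt with y Fin.≟ b | y Fin.≟ a
... | yes _ | yes _ = lt
... | yes _ | no _  = z<s
... | no _  | no _  = s≤s (pos0-delete q x≢a x≢b (≤-pred lt))

module _ (S : Subset n) where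

  Avoids : List (Fin n) → Set
  Avoids = All (λ x → inS S x ≡ false)

  -- The state (q , xs) of maeGo stands for the ordering q ++ xs: a requested head
  -- of xs jumps over the whole of q, and every other step leaves that ordering alone.
  maeGo-↭ : ∀ q xs → maeGo S q xs ↭ q ++ xs
  maeGo-↭ q [] = ↭-reflexive (sym (++-identityʳ q))
  maeGo-↭ q (x ∷ xs) with inS S x
  maeGo-↭ q (x ∷ xs) | true = ↭-trans (prep x (maeGo-↭ q xs)) (↭-sym (shift x q xs))
  maeGo-↭ [] (x ∷ xs) | false = prep x (maeGo-↭ [] xs)
  maeGo-↭ (y ∷ q) (x ∷ xs) | false =
    prep y (↭-trans (maeGo-↭ (q ++ [ x ]) xs) (↭-reflexive (++-assoc q [ x ] xs)))

  -- Each step consumes one element of `xs` and emits one, so a requested element comes out at its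
  -- own index in `xs`; what is emitted in an unrequested slot is never `a`.
  pos0-maeGo : ∀ {a} q xs → Avoids q → inS S a ≡ true → a ∈ xs → pos0 (maeGo S q xs) a ≡ pos0 xs a
  pos0-maeGo q (x ∷ xs) ns a∈S a∈ with inS S x in eq
  pos0-maeGo {a} q (x ∷ xs) ns a∈S a∈ | true with x Fin.≟ a | a∈
  ... | yes _  | _         = refl
  ... | no x≢a | here a≡x  = contradiction (sym a≡x) x≢a
  ... | no _   | there a∈′ = cong suc (pos0-maeGo q xs ns a∈S a∈′)
  pos0-maeGo q       (x ∷ xs) ns         a∈S (here refl) | false = true-false-elim a∈S eq
  pos0-maeGo []      (x ∷ xs) ns         a∈S (there a∈)  | false =
    trans (pos0-skip S {x} (maeGo S [] xs) eq a∈S)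
      (trans (cong suc (pos0-maeGo [] xs [] a∈S a∈)) (sym (pos0-skip S {x} xs eq a∈S)))
  pos0-maeGo (y ∷ q) (x ∷ xs) (y∉S ∷ ns) a∈S (there a∈)  | false =
    trans (pos0-skip S {y} (maeGo S (q ++ [ x ]) xs) y∉S a∈S)
      (trans (cong suc (pos0-maeGo (q ++ [ x ]) xs (++⁺ ns (eq ∷ [])) a∈S a∈)) (sym (pos0-skip S {x} xs eq a∈S)))

  -- The order changes only when a requested head of `xs` jumps over `q`, which contains no
  -- requested element. In the other steps the emitted element already heads `q ++ xs` and inverts
  -- nothing.
  maeGo-flips : ∀ {a b} q xs → Avoids q →
    pos0 (maeGo S q xs) a < pos0 (maeGo S q xs) b → pos0 (q ++ xs) b < pos0 (q ++ xs) a →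
    inS S a ≡ true × inS S b ≡ false
  maeGo-flips {a} {b} q [] ns after prior rewrite ++-identityʳ q = contradiction after (<-asym prior)
  maeGo-flips q (x ∷ xs) ns after prior with inS S x in eq
  maeGo-flips {a} {b} q (x ∷ xs) ns after prior | true with x Fin.≟ a | x Fin.≟ b
  ... | no x≢a   | no x≢b = maeGo-flips q xs ns (≤-pred after) (pos0-delete q x≢a x≢b prior)
  ... | yes refl | no x≢b with inS S b in eqb
  ...   | false = eq , refl
  -- A requested `b` cannot lie in `q`, so its index is at least `length q`, the index of `x`; yet
  -- `prior` puts it before `x`.
  ...   | true  = contradiction
    (subst (_< length q + 0) (pos0-++ S {b} q (x ∷ xs) ns eqb)
      (subst (pos0 (q ++ x ∷ xs) b <_)
        (trans (pos0-++ S {x} q (x ∷ xs) ns eq) (cong (length q +_) (pos0-self x xs))) prior))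
    (≤⇒≯ (+-monoʳ-≤ (length q) z≤n))
  maeGo-flips {a} {b} [] (x ∷ xs) ns after prior | false with x Fin.≟ a | x Fin.≟ b
  ... | no _ | no _ = maeGo-flips [] xs [] (≤-pred after) (≤-pred prior)
  maeGo-flips {a} {b} (y ∷ q) (x ∷ xs) (y∉S ∷ ns) after prior | false with y Fin.≟ a | y Fin.≟ b
  ... | no _ | no _ = maeGo-flips (q ++ [ x ]) xs (++⁺ ns (eq ∷ [])) (≤-pred after)
    (subst (λ zs → pos0 zs b < pos0 zs a) (sym (++-assoc q [ x ] xs)) (≤-pred prior))

  -- A view of the result of `spanᵇ`, abstracted jointly with the `with` inside `mae`.
  data Split (L : Ordering n) : List (Fin n) × List (Fin n) → Set where
    hit  : ∀ {q x xs} → q ++ x ∷ xs ≡ L → Avoids q → inS S x ≡ true → Split L (q , x ∷ xs)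
    miss : Avoids L → Split L (L , [])

  split : ∀ L → Split L (spanᵇ (λ e → not (inS S e)) L)
  split [] = miss []
  split (x ∷ L) with inS S x in eq
  ... | true  = hit refl [] eq
  ... | false with spanᵇ (λ e → not (inS S e)) L | split L
  ...   | _ | hit L≡ ns x∈S = hit (cong (x ∷_) L≡) (eq ∷ ns) x∈S
  ...   | _ | miss ns       = miss (eq ∷ ns)

-- Access cost and the effect of one step.

access-≤ : ∀ (L : Ordering n) S {e} → inS S e ≡ true → access L S ≤ pos L e
access-≤ {n} L S {e} e∈S = go (∈-allFin e)
  where
  go : ∀ {xs} → e ∈ xs → foldr (λ e acc → if inS S e then pos L e ⊓ acc else acc) n xs ≤ pos L e
  go (here refl) rewrite e∈S = m⊓n≤m _ _
  go {x ∷ xs} (there e∈) with inS S x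
  ... | true  = ≤-trans (m⊓n≤n (pos L x) _) (go e∈)
  ... | false = go e∈

access-attained : ∀ {L : Ordering n} S {e} → L ↭ allFin n → inS S e ≡ true →
                  ∃[ f ] inS S f ≡ true × pos L f ≤ access L S
access-attained {n} {L} S {e} perm e∈S = go (allFin n)
  where
  go : ∀ xs → ∃[ f ] inS S f ≡ true × pos L f ≤ foldr (λ e acc → if inS S e then pos L e ⊓ acc else acc) n xs
  -- The initial value `n` of the fold is at least every position, so any requested element is a
  -- witness.
  go [] = e , e∈S , pos0-<n perm e
  go (x ∷ xs) with inS S x in eq | go xs
  ... | false | ih = ih
  ... | true  | f , f∈S , f≤ with ≤-total (pos L x) (pos L f)
  ...   | inj₁ x≤f = x , eq , ⊓-glb ≤-refl (≤-trans x≤f f≤)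
  ...   | inj₂ f≤x = f , f∈S , ⊓-glb f≤x f≤

-- All that the analysis uses of one step. Here `q` is k - 1, the length of the prefix before the
-- first requested element.
record Moved (S : Subset n) (L M : Ordering n) (q : ℕ) : Set where
  field
    perm   : M ↭ L
    access-≤-suc : access L S ≤ suc q
    shift-S : ∀ {a} → inS S a ≡ true → pos0 M a + q ≡ pos0 L a
    flips   : ∀ {a b} → pos0 M a < pos0 M b → pos0 L b < pos0 L a → inS S a ≡ true × inS S b ≡ false

mae-moved : ∀ (S : Subset n) {e} L → L ↭ allFin n → inS S e ≡ true → ∃[ q ] Moved S L (mae L S) q
mae-moved S {e} L p e∈S with spanᵇ (λ e → not (inS S e)) L | split S L
... | _ | miss ns = true-false-elim e∈S (All.lookup ns (complete p e))
... | q , x ∷ xs | hit refl ns x∈S = length q , record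
  { perm         = maeGo-↭ S q (x ∷ xs)
  ; access-≤-suc = ≤-trans (access-≤ L S x∈S) (s≤s (≤-reflexive (begin-equality
      pos0 L x                       ≡⟨ pos0-++ S {x} q (x ∷ xs) ns x∈S ⟩
      length q + pos0 (x ∷ xs) x     ≡⟨ cong (length q +_) (pos0-self x xs) ⟩
      length q + 0                   ≡⟨ +-identityʳ _ ⟩
      length q                       ∎)))
  ; shift-S      = λ {a} a∈S → begin-equality
      pos0 (maeGo S q (x ∷ xs)) a + length q   ≡⟨ cong (_+ length q) (pos0-maeGo S q (x ∷ xs) ns a∈S (in-rest a∈S)) ⟩
      pos0 (x ∷ xs) a + length q               ≡⟨ +-comm _ (length q) ⟩
      length q + pos0 (x ∷ xs) a               ≡⟨ pos0-++ S {a} q (x ∷ xs) ns a∈S ⟨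
      pos0 L a                                 ∎
  ; flips        = maeGo-flips S q (x ∷ xs) ns
  }
  where
  open ≤-Reasoning
  in-rest : ∀ {a} → inS S a ≡ true → a ∈ x ∷ xs
  in-rest {a} a∈S with ∈-++⁻ q (complete p a)
  ... | inj₁ a∈q = true-false-elim a∈S (All.lookup ns a∈q)
  ... | inj₂ a∈  = a∈

module _ {S : Subset n} {L M : Ordering n} {q} (moved : Moved S L M q) (pL : L ↭ allFin n) where
  open Moved moved

  private
    pM : M ↭ allFin n
    pM = ↭-trans perm pL

  -- An element falls back only because others overtake it, and by `flips` all of these are
  -- requested.
  pos0-rise : ∀ e → pos0 M e ≤ pos0 L e + ∣ S ∣
  pos0-rise e = begin
    pos0 M e                                                    ≡⟨ pos0-rank pM e ⟩
    ∑ (allFin n) (λ b → ⟦ before M b e ⟧)                       ≤⟨ ∑-mono (allFin n) pointwise ⟩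
    ∑ (allFin n) (λ b → ⟦ before L b e ⟧ + ⟦ inS S b ⟧)         ≡⟨ ∑-+ (allFin n) _ _ ⟩
    ∑ (allFin n) (λ b → ⟦ before L b e ⟧) + ∑ (allFin n) (λ b → ⟦ inS S b ⟧)
                                                                ≡⟨ cong₂ _+_ (sym (pos0-rank pL e)) (∑-inS S) ⟩
    pos0 L e + ∣ S ∣                                            ∎
    where
    open ≤-Reasoning
    pointwise : ∀ b → ⟦ before M b e ⟧ ≤ ⟦ before L b e ⟧ + ⟦ inS S b ⟧
    pointwise b with <-≤-connex (pos0 M b) (pos0 M e)
    ... | inj₂ e≤b rewrite <ᵇ-false e≤b = z≤n
    ... | inj₁ b<e rewrite <ᵇ-true b<e with <-cmp (pos0 L b) (pos0 L e)
    ...   | tri< lt _ _ rewrite <ᵇ-true lt = m≤m+n 1 _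
    ...   | tri≈ _ eq _ = contradiction (cong (pos0 M) (pos0-injective (complete pL b) eq)) (<⇒≢ b<e)
    ...   | tri> _ _ gt rewrite proj₁ (flips b<e gt) = m≤n+m 1 _

  crossed : Fin n → Fin n → ℕ
  crossed a b = if inS S a then ⟦ before L b a ∧ before M a b ⟧ else 0

  -- Nothing overtakes a requested `a`, so the elements it overtakes number at most its gain in
  -- position, which is `q`.
  ∑-crossed : ∀ a → ∑ (allFin n) (crossed a) ≤ q * ⟦ inS S a ⟧
  ∑-crossed a with inS S a in a∈S
  ... | false = ≤-trans (≤-reflexive (∑-zero (allFin n))) z≤n
  -- Adding `pos0 M a` to both sides avoids subtraction.
  ... | true = subst (_ ≤_) (sym (*-identityʳ q)) (+-cancelˡ-≤ (pos0 M a) _ _ (begin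
    pos0 M a + ∑ (allFin n) (λ b → ⟦ before L b a ∧ before M a b ⟧)
      ≡⟨ cong (_+ ∑ (allFin n) (λ b → ⟦ before L b a ∧ before M a b ⟧)) (pos0-rank pM a) ⟩
    ∑ (allFin n) (λ b → ⟦ before M b a ⟧) + ∑ (allFin n) (λ b → ⟦ before L b a ∧ before M a b ⟧)
      ≡⟨ ∑-+ (allFin n) _ _ ⟨
    ∑ (allFin n) (λ b → ⟦ before M b a ⟧ + ⟦ before L b a ∧ before M a b ⟧)
      ≤⟨ ∑-mono (allFin n) pointwise ⟩
    ∑ (allFin n) (λ b → ⟦ before L b a ⟧)
      ≡⟨ pos0-rank pL a ⟨
    pos0 L a
      ≡⟨ shift-S a∈S ⟨
    pos0 M a + q ∎))
    where
    open ≤-Reasoning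
    pointwise : ∀ b → ⟦ before M b a ⟧ + ⟦ before L b a ∧ before M a b ⟧ ≤ ⟦ before L b a ⟧
    pointwise b with <-≤-connex (pos0 M b) (pos0 M a)
    ... | inj₂ a≤b rewrite <ᵇ-false a≤b = ∧-≤ (before L b a) _
      where
      ∧-≤ : ∀ x y → ⟦ x ∧ y ⟧ ≤ ⟦ x ⟧
      ∧-≤ false y     = z≤n
      ∧-≤ true  false = z≤n
      ∧-≤ true  true  = ≤-refl
    ... | inj₁ b<a rewrite <ᵇ-true b<a | <ᵇ-false (<⇒≤ b<a) with <-cmp (pos0 L b) (pos0 L a)
    ...   | tri< lt _ _ rewrite <ᵇ-true lt = ≤-refl
    ...   | tri≈ _ eq _ = contradiction (cong (pos0 M) (pos0-injective (complete pL b) eq)) (<⇒≢ b<a)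
    ...   | tri> _ _ gt = true-false-elim a∈S (proj₂ (flips b<a gt))

  -- Every inverted pair consists of a requested element and one it overtakes, and each requested
  -- element overtakes at most `q` others. The factor 2 comes from `∑-symmetrise`.
  dKT-moved : dKT L M ≤ 2 * (q * ∣ S ∣)
  dKT-moved = begin
    dKT L M                                             ≤⟨ ∑-symmetrise (allFin n) _ crossed pointwise ⟩
    2 * ∑ (allFin n) (λ a → ∑ (allFin n) (crossed a))   ≤⟨ *-monoʳ-≤ 2 (∑-mono (allFin n) ∑-crossed) ⟩
    2 * ∑ (allFin n) (λ a → q * ⟦ inS S a ⟧)            ≡⟨ cong (2 *_) (trans (∑-*ˡ q (allFin n) _) (cong (q *_) (∑-inS S))) ⟩
    2 * (q * ∣ S ∣)                                     ∎
    where
    open ≤-Reasoning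
    xor-≤ : ∀ {a b} → pos0 L a < pos0 L b → disagree L M a b ≤ crossed b a
    xor-≤ {a} {b} a<b rewrite <ᵇ-true a<b with <-cmp (pos0 M a) (pos0 M b)
    ... | tri< lt _ _ rewrite <ᵇ-true lt = z≤n
    ... | tri≈ _ eq _ = contradiction (cong (pos0 L) (pos0-injective (complete pM a) eq)) (<⇒≢ a<b)
    ... | tri> _ _ gt rewrite proj₁ (flips gt a<b) | <ᵇ-true gt = ⟦⟧≤1 (not (before M a b))
      where
      ⟦⟧≤1 : ∀ x → ⟦ x ⟧ ≤ 1
      ⟦⟧≤1 true  = ≤-refl
      ⟦⟧≤1 false = z≤n
    xor-≥ : ∀ {a b} → pos0 L b < pos0 L a → disagree L M a b ≤ crossed a b
    xor-≥ {a} {b} b<a rewrite <ᵇ-true b<a | <ᵇ-false (<⇒≤ b<a) with <-≤-connex (pos0 M a) (pos0 M b)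
    ... | inj₁ a<b rewrite proj₁ (flips a<b b<a) | <ᵇ-true a<b = ≤-refl
    ... | inj₂ b≤a rewrite <ᵇ-false b≤a = z≤n
    pointwise : ∀ a b → (if does (a <? b) then disagree L M a b else 0) ≤ crossed a b + crossed b a
    pointwise a b with <-≤-connex (Fin.toℕ a) (Fin.toℕ b)
    ... | inj₂ b≤a rewrite <ᵇ-false b≤a = z≤n
    ... | inj₁ a<b rewrite <ᵇ-true a<b with <-cmp (pos0 L a) (pos0 L b)
    ...   | tri< lt _ _ = ≤-trans (xor-≤ lt) (m≤n+m _ _)
    ...   | tri≈ _ eq _ = contradiction (pos0-injective (complete pL a) eq) (Fin.<⇒≢ a<b)
    ...   | tri> _ _ gt = ≤-trans (xor-≥ gt) (m≤m+n _ _)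

-- The potential function.

-- Positions in `P` are distinct, so the weights sum to at most W + (W - 1) + ... + 1.
∑-weight-unique : ∀ {P : Ordering n} W → Unique P → ∑ P (λ e → W ∸ pos0 P e) ≤ W * W
∑-weight-unique {P = P} zero uniq = ≤-reflexive (trans (∑-cong-∈ P (λ {b} _ → 0∸n≡0 (pos0 P b))) (∑-zero P))
∑-weight-unique {P = []} (suc w) _ = z≤n
∑-weight-unique {P = x ∷ P} (suc w) (x∉ ∷ uniq) = begin
  (suc w ∸ pos0 (x ∷ P) x) + ∑ P (λ e → suc w ∸ pos0 (x ∷ P) e)
    ≡⟨ cong₂ _+_ (cong (suc w ∸_) (pos0-self x P))
                 (∑-cong-∈ P (λ b∈ → cong (suc w ∸_) (pos0-tail P (All.lookup x∉ b∈)))) ⟩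
  suc w + ∑ P (λ e → w ∸ pos0 P e)     ≤⟨ +-monoʳ-≤ (suc w) (∑-weight-unique w uniq) ⟩
  suc w + w * w                        ≤⟨ +-monoʳ-≤ (suc w) (*-monoʳ-≤ w (n≤1+n w)) ⟩
  suc w * suc w                        ∎
  where open ≤-Reasoning

∑-weight : ∀ {P : Ordering n} W → P ↭ allFin n → ∑ (allFin n) (λ e → W ∸ pos0 P e) ≤ W * W
∑-weight W pP = subst (_≤ W * W) (∑-↭ _ pP) (∑-weight-unique W (unique pP))

-- `L` belongs to Move-All-Equally and `P` to the optimum. Truncated subtraction leaves weight only
-- on the first `W` elements of `P`.
Φ : ℕ → Ordering n → Ordering n → ℕ
Φ {n} W L P = ∑ (allFin n) (λ e → (W ∸ pos0 P e) * pos0 L e)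

-- Bounds the initial potential, which ends up in the additive constant.
Φ-≤ : ∀ W {L : Ordering n} (P : Ordering n) → L ↭ allFin n → Φ W L P ≤ n * (W * n)
Φ-≤ {n} W {L} P pL = begin
  Φ W L P                        ≤⟨ ∑-mono (allFin n) (λ e → *-mono-≤ (m∸n≤m W (pos0 P e)) (<⇒≤ (pos0-<n pL e))) ⟩
  ∑ (allFin n) (λ _ → W * n)     ≡⟨ ∑-const (allFin n) (W * n) ⟩
  length (allFin n) * (W * n)    ≡⟨ cong (_* (W * n)) (length-tabulate {n = n} id) ⟩
  n * (W * n)                    ∎
  where open ≤-Reasoning

-- The weight of `e` grows by at most the number `D e` of disagreements it is part of, and is
-- multiplied by a position below `n`. Each swapped pair enters `D` at both of its ends, hence the
-- 2.
Φ-switch : ∀ W {L P Q : Ordering n} → L ↭ allFin n → P ↭ allFin n → Q ↭ allFin n →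
           Φ W L Q ≤ Φ W L P + n * (2 * dKT P Q)
Φ-switch {n} W {L} {P} {Q} pL pP pQ = begin
  Φ W L Q                                                           ≤⟨ ∑-mono (allFin n) pointwise ⟩
  ∑ (allFin n) (λ e → (W ∸ pos0 P e) * pos0 L e + n * D e)          ≡⟨ ∑-+ (allFin n) _ (λ e → n * D e) ⟩
  Φ W L P + ∑ (allFin n) (λ e → n * D e)                            ≡⟨ cong (Φ W L P +_) (∑-*ˡ n (allFin n) D) ⟩
  Φ W L P + n * ∑ (allFin n) D                                      ≡⟨ cong (λ t → Φ W L P + n * t) (∑-swap (allFin n) (allFin n) (λ e b → disagree P Q b e)) ⟩
  Φ W L P + n * ∑ (allFin n) (λ b → ∑ (allFin n) (disagree P Q b))  ≤⟨ +-monoʳ-≤ (Φ W L P) (*-monoʳ-≤ n (∑-disagree pP pQ)) ⟩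
  Φ W L P + n * (2 * dKT P Q)                                       ∎
  where
  open ≤-Reasoning
  D : Fin n → ℕ
  D e = ∑ (allFin n) (λ b → disagree P Q b e)
  weight-≤ : ∀ e → W ∸ pos0 Q e ≤ (W ∸ pos0 P e) + D e
  weight-≤ e = m≤n+o⇒m∸n≤o W (pos0 Q e) (begin
    W                                          ≤⟨ m≤n+m∸n W (pos0 P e) ⟩
    pos0 P e + (W ∸ pos0 P e)                  ≤⟨ +-monoˡ-≤ (W ∸ pos0 P e) (pos0-≤-disagree pP pQ e) ⟩
    pos0 Q e + D e + (W ∸ pos0 P e)            ≡⟨ +-assoc (pos0 Q e) (D e) _ ⟩
    pos0 Q e + (D e + (W ∸ pos0 P e))          ≡⟨ cong (pos0 Q e +_) (+-comm (D e) _) ⟩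
    pos0 Q e + ((W ∸ pos0 P e) + D e)          ∎)
  pointwise : ∀ e → (W ∸ pos0 Q e) * pos0 L e ≤ (W ∸ pos0 P e) * pos0 L e + n * D e
  pointwise e = begin
    (W ∸ pos0 Q e) * pos0 L e                      ≤⟨ *-monoˡ-≤ (pos0 L e) (weight-≤ e) ⟩
    ((W ∸ pos0 P e) + D e) * pos0 L e              ≡⟨ *-distribʳ-+ (pos0 L e) (W ∸ pos0 P e) (D e) ⟩
    (W ∸ pos0 P e) * pos0 L e + D e * pos0 L e     ≤⟨ +-monoʳ-≤ _ (*-monoʳ-≤ (D e) (<⇒≤ (pos0-<n pL e))) ⟩
    (W ∸ pos0 P e) * pos0 L e + D e * n            ≡⟨ cong ((W ∸ pos0 P e) * pos0 L e +_) (*-comm (D e) n) ⟩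
    (W ∸ pos0 P e) * pos0 L e + n * D e            ∎

module _ {S : Subset n} {L M : Ordering n} {q} (moved : Moved S L M q) (pL : L ↭ allFin n)
         {P : Ordering n} (pP : P ↭ allFin n) where
  open Moved moved
  open ≤-Reasoning

  -- Requested elements lower the potential by their weight times `q`, of which only the share of
  -- `f` is kept. The others raise it by at most `∣ S ∣` times their weight, and the total weight is
  -- at most W².
  Φ-drop : ∀ W {f} → inS S f ≡ true → (W ∸ pos0 P f) * q + Φ W M P ≤ Φ W L P + ∣ S ∣ * (W * W)
  Φ-drop W {f} f∈S = begin
    w f * q + Φ W M P                                                   ≡⟨ cong (_+ Φ W M P) drop-f ⟩
    drop f + Φ W M P                                                    ≤⟨ +-monoˡ-≤ (Φ W M P) (∑-∈ drop (∈-allFin f)) ⟩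
    ∑ (allFin n) drop + Φ W M P                                         ≡⟨ ∑-+ (allFin n) drop _ ⟨
    ∑ (allFin n) (λ e → drop e + w e * pos0 M e)                        ≤⟨ ∑-mono (allFin n) pointwise ⟩
    ∑ (allFin n) (λ e → w e * pos0 L e + ∣ S ∣ * w e)                   ≡⟨ ∑-+ (allFin n) _ (λ e → ∣ S ∣ * w e) ⟩
    Φ W L P + ∑ (allFin n) (λ e → ∣ S ∣ * w e)                          ≡⟨ cong (Φ W L P +_) (∑-*ˡ ∣ S ∣ (allFin n) w) ⟩
    Φ W L P + ∣ S ∣ * ∑ (allFin n) w                                    ≤⟨ +-monoʳ-≤ (Φ W L P) (*-monoʳ-≤ ∣ S ∣ (∑-weight W pP)) ⟩
    Φ W L P + ∣ S ∣ * (W * W)                                           ∎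
    where
    w drop : Fin n → ℕ
    w e = W ∸ pos0 P e
    drop e = if inS S e then w e * q else 0
    drop-f : w f * q ≡ drop f
    drop-f rewrite f∈S = refl
    pointwise : ∀ e → drop e + w e * pos0 M e ≤ w e * pos0 L e + ∣ S ∣ * w e
    pointwise e with inS S e in e∈S
    ... | true = begin
      w e * q + w e * pos0 M e           ≡⟨ *-distribˡ-+ (w e) q (pos0 M e) ⟨
      w e * (q + pos0 M e)               ≡⟨ cong (w e *_) (trans (+-comm q _) (shift-S e∈S)) ⟩
      w e * pos0 L e                     ≤⟨ m≤m+n _ _ ⟩
      w e * pos0 L e + ∣ S ∣ * w e       ∎
    ... | false = begin
      w e * pos0 M e                     ≤⟨ *-monoʳ-≤ (w e) (pos0-rise moved pL e) ⟩
      w e * (pos0 L e + ∣ S ∣)           ≡⟨ *-distribˡ-+ (w e) (pos0 L e) ∣ S ∣ ⟩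
      w e * pos0 L e + w e * ∣ S ∣       ≡⟨ cong (w e * pos0 L e +_) (*-comm (w e) ∣ S ∣) ⟩
      w e * pos0 L e + ∣ S ∣ * w e       ∎

  -- The term `n * access P S` is slack when the optimum finds a requested element early, and pays
  -- for `s * q` when it does not.
  Φ-step : ∀ s {e} → inS S e ≡ true →
           s * q + Φ (2 * s) M P ≤ Φ (2 * s) L P + ∣ S ∣ * (2 * s * (2 * s)) + n * access P S
  Φ-step s {e} e∈S with f , f∈S , f≤ ← access-attained S {e} pP e∈S with ≤-<-connex (access P S) s
  -- Here `pos0 P f` is less than `s`, so `f` has weight at least `s`.
  ... | inj₁ near = begin
    s * q + Φ (2 * s) M P                             ≤⟨ +-monoˡ-≤ _ (*-monoˡ-≤ q (m+n≤o⇒m≤o∸n s (+-monoʳ-≤ s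
                                                           (≤-trans (≤-trans (n≤1+n _) (≤-trans f≤ near)) (m≤m+n s 0))))) ⟩
    (2 * s ∸ pos0 P f) * q + Φ (2 * s) M P            ≤⟨ Φ-drop (2 * s) {f} f∈S ⟩
    Φ (2 * s) L P + ∣ S ∣ * (2 * s * (2 * s))         ≤⟨ m≤m+n _ _ ⟩
    _                                                 ∎
  -- The drop is discarded. That `q` is at most `n` holds because `f` advances by `q` positions.
  ... | inj₂ far = begin
    s * q + Φ (2 * s) M P                                       ≤⟨ +-mono-≤ (*-mono-≤ (<⇒≤ far) q≤n) (≤-trans (m≤n+m _ _) (Φ-drop (2 * s) {f} f∈S)) ⟩
    access P S * n + (Φ (2 * s) L P + ∣ S ∣ * (2 * s * (2 * s)))  ≡⟨ +-comm (access P S * n) _ ⟩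
    Φ (2 * s) L P + ∣ S ∣ * (2 * s * (2 * s)) + access P S * n    ≡⟨ cong (Φ (2 * s) L P + ∣ S ∣ * (2 * s * (2 * s)) +_) (*-comm (access P S) n) ⟩
    Φ (2 * s) L P + ∣ S ∣ * (2 * s * (2 * s)) + n * access P S    ∎
    where
    q≤n : q ≤ n
    q≤n = ≤-trans (m≤n+m q (pos0 M f)) (≤-trans (≤-reflexive (shift-S f∈S)) (<⇒≤ (pos0-<n pL f)))

-- Amortised cost of a request and of a sequence.

-- The optimum pays its access in the new ordering `Q`, so the potential is switched from `P` to `Q`
-- before the step is analysed. In `6 * n`, 4n bounds the rise from unrequested elements, n bounds
-- the `s` left over from `suc q`, and n comes from `Φ-step`; the first two are charged to the
-- access cost, which is at least 1.
cost-step : ∀ {S : Subset n} {L P Q : Ordering n} s → L ↭ allFin n → P ↭ allFin n → Q ↭ allFin n →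
            1 ≤ ∣ S ∣ → s * s * ∣ S ∣ ≤ n →
            s * (access L S + dKT L (mae L S)) + 3 * ∣ S ∣ * Φ (2 * s) (mae L S) Q
              ≤ 3 * ∣ S ∣ * (Φ (2 * s) L P + 6 * n * (access Q S + dKT P Q))
cost-step {n} {S} {L} {P} {Q} s pL pP pQ 1≤r s²r≤n
  with e , e∈S ← nonempty S 1≤r with q , moved ← mae-moved S L pL e∈S = begin
    s * (access L S + dKT L M) + 3 * ρ * ΦMQ                        ≤⟨ +-monoˡ-≤ (3 * ρ * ΦMQ) (*-monoʳ-≤ s cost-≤) ⟩
    s * (3 * ρ * suc q) + 3 * ρ * ΦMQ                               ≡⟨ factor s ρ q ΦMQ ⟩
    3 * ρ * (s * q + ΦMQ + s)                                       ≤⟨ *-monoʳ-≤ (3 * ρ) (begin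
      s * q + ΦMQ + s                                                 ≤⟨ +-mono-≤ (Φ-step moved pL pQ s e∈S) s≤n ⟩
      Φ (2 * s) L Q + ρ * (2 * s * (2 * s)) + n * acc + n             ≤⟨ +-monoˡ-≤ n (+-monoˡ-≤ (n * acc) (+-mono-≤ (Φ-switch (2 * s) pL pP pQ) weight-≤)) ⟩
      -- The slack `4 * n * d` gives movement the same coefficient 6n as access.
      ΦLP + n * (2 * d) + 4 * n + n * acc + n                         ≤⟨ m≤m+n _ (4 * n * d) ⟩
      ΦLP + n * (2 * d) + 4 * n + n * acc + n + 4 * n * d             ≡⟨ collect ΦLP n d acc ⟩
      ΦLP + (n * acc + 6 * n * d + 5 * n * 1)                         ≤⟨ +-monoʳ-≤ ΦLP (+-monoʳ-≤ (n * acc + 6 * n * d) (*-monoʳ-≤ (5 * n) 1≤acc)) ⟩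
      ΦLP + (n * acc + 6 * n * d + 5 * n * acc)                       ≡⟨ cong (ΦLP +_) (regroup n d acc) ⟩
      ΦLP + 6 * n * (acc + d)                                         ∎) ⟩
    3 * ρ * (ΦLP + 6 * n * (acc + d))                               ∎
  where
  open ≤-Reasoning
  M = mae L S
  ρ = ∣ S ∣
  ΦMQ = Φ (2 * s) M Q
  ΦLP = Φ (2 * s) L P
  acc = access Q S
  d = dKT P Q
  factor : ∀ s ρ q z → s * (3 * ρ * suc q) + 3 * ρ * z ≡ 3 * ρ * (s * q + z + s)
  factor = solve-∀
  collect : ∀ z n d a → z + n * (2 * d) + 4 * n + n * a + n + 4 * n * d ≡ z + (n * a + 6 * n * d + 5 * n * 1)
  collect = solve-∀
  regroup : ∀ n d a → n * a + 6 * n * d + 5 * n * a ≡ 6 * n * (a + d)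
  regroup = solve-∀
  square-double : ∀ ρ s → ρ * (2 * s * (2 * s)) ≡ 4 * (s * s * ρ)
  square-double = solve-∀
  weight-≤ : ρ * (2 * s * (2 * s)) ≤ 4 * n
  weight-≤ = ≤-trans (≤-reflexive (square-double ρ s)) (*-monoʳ-≤ 4 s²r≤n)
  m≤m*m : ∀ m → m ≤ m * m
  m≤m*m zero    = z≤n
  m≤m*m (suc m) = m≤m+n (suc m) _
  s≤n : s ≤ n
  s≤n = ≤-trans (m≤m*m s) (≤-trans (m≤m*n (s * s) ρ {{>-nonZero 1≤r}}) s²r≤n)
  1≤acc : 1 ≤ acc
  1≤acc with f , _ , f≤ ← access-attained S pQ (proj₂ (nonempty S 1≤r)) = ≤-trans z<s f≤
  expand : ∀ q ρ → 1 * ρ + ρ * q + 2 * (q * ρ) + 2 * ρ ≡ 3 * ρ * suc q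
  expand = solve-∀
  cost-≤ : access L S + dKT L M ≤ 3 * ρ * suc q
  cost-≤ = begin
    access L S + dKT L M                       ≤⟨ +-mono-≤ (Moved.access-≤-suc moved) (dKT-moved moved pL) ⟩
    suc q + 2 * (q * ρ)                        ≤⟨ +-monoˡ-≤ (2 * (q * ρ)) (+-mono-≤ (≤-trans 1≤r (≤-reflexive (sym (*-identityˡ ρ)))) (m≤n*m q ρ {{>-nonZero 1≤r}})) ⟩
    -- The slack `2 * ρ` completes a multiple of `suc q`.
    1 * ρ + ρ * q + 2 * (q * ρ)                ≤⟨ m≤m+n _ (2 * ρ) ⟩
    1 * ρ + ρ * q + 2 * (q * ρ) + 2 * ρ        ≡⟨ expand q ρ ⟩
    3 * ρ * suc q                              ∎

-- The bounds of `cost-step` telescope and the final potential is dropped. `P` is kept apart from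
-- `L` for the induction, although both start at the initial ordering.
cost-≤-Φ : ∀ {L P : Ordering n} s → L ↭ allFin n → P ↭ allFin n → 1 ≤ r → s * s * r ≤ n →
           ∀ reqs → All (λ S → ∣ S ∣ ≡ r) reqs → ∀ adv → All (λ Q → Q ↭ allFin n) adv → length adv ≡ length reqs →
           s * maeCost L reqs ≤ 3 * r * (Φ (2 * s) L P + 6 * n * offCost P reqs adv)
cost-≤-Φ s pL pP 1≤r s²r≤n [] _ _ _ _ = ≤-trans (≤-reflexive (*-zeroʳ s)) z≤n
cost-≤-Φ {n} {r} {L} {P} s pL pP 1≤r s²r≤n (S ∷ reqs) (refl ∷ sizes) (Q ∷ adv) (pQ ∷ pAdv) len = begin
  s * (c + maeCost M reqs)                                  ≡⟨ *-distribˡ-+ s c (maeCost M reqs) ⟩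
  s * c + s * maeCost M reqs                                ≤⟨ +-monoʳ-≤ (s * c) (cost-≤-Φ s pM pQ 1≤r s²r≤n reqs sizes adv pAdv (suc-injective len)) ⟩
  s * c + 3 * r * (Φ (2 * s) M Q + 6 * n * o)               ≡⟨ split-sum (s * c) r (Φ (2 * s) M Q) n o ⟩
  s * c + 3 * r * Φ (2 * s) M Q + 3 * r * (6 * n * o)       ≤⟨ +-monoˡ-≤ (3 * r * (6 * n * o)) (cost-step s pL pP pQ 1≤r s²r≤n) ⟩
  3 * r * (Φ (2 * s) L P + 6 * n * a) + 3 * r * (6 * n * o) ≡⟨ join-sum r (Φ (2 * s) L P) n a o ⟩
  3 * r * (Φ (2 * s) L P + 6 * n * (a + o))                 ∎
  where
  open ≤-Reasoning
  M = mae L S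
  c = access L S + dKT L M
  a = access Q S + dKT P Q
  o = offCost Q reqs adv
  pM : M ↭ allFin n
  pM = ↭-trans (Moved.perm (proj₂ (mae-moved S L pL (proj₂ (nonempty S 1≤r))))) pL
  split-sum : ∀ x r z n o → x + 3 * r * (z + 6 * n * o) ≡ x + 3 * r * z + 3 * r * (6 * n * o)
  split-sum = solve-∀
  join-sum : ∀ r z n a o → 3 * r * (z + 6 * n * a) + 3 * r * (6 * n * o) ≡ 3 * r * (z + 6 * n * (a + o))
  join-sum = solve-∀

-- The choice of s and the competitive ratio.

-- `s` is the integer part of √(n/r); as `n` grows by one, it grows by at most one.
floor-sqrt : ∀ r n → 1 ≤ r → ∃[ s ] s * s * r ≤ n × n < suc s * suc s * r
floor-sqrt r zero    1≤r = 0 , z≤n , ≤-trans 1≤r (m≤m+n r 0)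
floor-sqrt r (suc n) 1≤r with s , s²r≤n , n< ← floor-sqrt r n 1≤r with ≤-<-connex (suc s * suc s * r) (suc n)
... | inj₂ sn<   = s , m≤n⇒m≤1+n s²r≤n , sn<
... | inj₁ next≤ = suc s , next≤ , ≤-<-trans n< (*-monoˡ-< r {{>-nonZero 1≤r}} (*-mono-< (n<1+n (suc s)) (n<1+n (suc s))))

-- Squaring avoids real roots: K r³ n is the square of C r^(3/2) √n. Since `adv` is an arbitrary
-- offline sequence, the bound holds for the optimal one.
theorem4 : ∃[ K ] ∀ (n r : ℕ) → 1 ≤ r → ∃[ α ]
    ∀ (π₀ : Ordering n) → π₀ ↭ allFin n →
    ∀ (reqs : List (Subset n)) → All (λ S → ∣ S ∣ ≡ r) reqs →
    ∀ (adv : List (Ordering n)) → All (λ P → P ↭ allFin n) adv → length adv ≡ length reqs →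
    (maeCost π₀ reqs ∸ α) ^ 2 ≤ K * r ^ 3 * n * offCost π₀ reqs adv ^ 2
-- 1296 is 4 · 18², with 18 = 3 · 6 from `cost-≤-Φ` and 4 from s + 1 ≤ 2s. The additive constant is
-- the initial bound 3r · n · 2s · n divided by `s`.
theorem4 = 1296 , λ n r 1≤r → 6 * r * n * n , bound n r 1≤r
  where
  open ≤-Reasoning
  bound : ∀ n r → 1 ≤ r → ∀ (π₀ : Ordering n) → π₀ ↭ allFin n →
    ∀ (reqs : List (Subset n)) → All (λ S → ∣ S ∣ ≡ r) reqs →
    ∀ (adv : List (Ordering n)) → All (λ P → P ↭ allFin n) adv → length adv ≡ length reqs →
    (maeCost π₀ reqs ∸ 6 * r * n * n) ^ 2 ≤ 1296 * r ^ 3 * n * offCost π₀ reqs adv ^ 2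
  -- Only an actual request forces r ≤ n, and with it s ≥ 1, so the empty sequence is treated apart.
  bound n r 1≤r π₀ p [] _ _ _ _ = ≤-trans (≤-reflexive (cong (_^ 2) (0∸n≡0 (6 * r * n * n)))) z≤n
  bound n r 1≤r π₀ p reqs@(S ∷ _) sizes@(∣S∣≡r ∷ _) adv pAdv len
    with floor-sqrt r n 1≤r
  ... | zero , _ , n<r = contradiction (subst (_≤ n) ∣S∣≡r (∣p∣≤n S)) (<⇒≱ (subst (n <_) (+-identityʳ r) n<r))
  ... | s@(suc _) , s²r≤n , n< =
    -- The factor `n` is traded for (2s)² r, so that the bound on `s * X` can be squared.
    *-cancelˡ-≤ n {{>-nonZero (≤-trans 1≤r (subst (_≤ n) ∣S∣≡r (∣p∣≤n S)))}} (begin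
      n * X ^ 2                                  ≤⟨ *-monoˡ-≤ (X ^ 2) (≤-trans (<⇒≤ n<) (*-monoˡ-≤ r (*-mono-≤ 1+s≤2s 1+s≤2s))) ⟩
      2 * s * (2 * s) * r * X ^ 2                ≡⟨ square-out s r X ⟩
      4 * r * ((s * X) * (s * X))                ≤⟨ *-monoʳ-≤ (4 * r) (*-mono-≤ sX≤ sX≤) ⟩
      4 * r * (18 * r * n * O * (18 * r * n * O)) ≡⟨ square-in r n O ⟩
      n * (1296 * r ^ 3 * n * O ^ 2)             ∎)
    where
    C = maeCost π₀ reqs
    O = offCost π₀ reqs adv
    X = C ∸ 6 * r * n * n
    1+s≤2s : suc s ≤ 2 * s
    1+s≤2s = +-mono-≤ {1} (s≤s z≤n) (≤-reflexive (sym (+-identityʳ s)))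
    square-out : ∀ s r x → 2 * s * (2 * s) * r * (x * (x * 1)) ≡ 4 * r * ((s * x) * (s * x))
    square-out = solve-∀
    square-in : ∀ r n o → 4 * r * (18 * r * n * o * (18 * r * n * o)) ≡ n * (1296 * (r * (r * (r * 1))) * n * (o * (o * 1)))
    square-in = solve-∀
    absorb : ∀ r n s o → 3 * r * (n * (2 * s * n) + 6 * n * o) ≡ s * (6 * r * n * n) + 18 * r * n * o
    absorb = solve-∀
    sX≤ : s * X ≤ 18 * r * n * O
    sX≤ = begin
      s * X                                ≡⟨ *-distribˡ-∸ s C (6 * r * n * n) ⟩
      s * C ∸ s * (6 * r * n * n)          ≤⟨ m≤n+o⇒m∸n≤o (s * C) (s * (6 * r * n * n)) (begin
        s * C                                            ≤⟨ cost-≤-Φ s p p 1≤r s²r≤n reqs sizes adv pAdv len ⟩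
        3 * r * (Φ (2 * s) π₀ π₀ + 6 * n * O)            ≤⟨ *-monoʳ-≤ (3 * r) (+-monoˡ-≤ (6 * n * O) (Φ-≤ (2 * s) π₀ p)) ⟩
        3 * r * (n * (2 * s * n) + 6 * n * O)            ≡⟨ absorb r n s O ⟩
        s * (6 * r * n * n) + 18 * r * n * O             ∎) ⟩
      18 * r * n * O                       ∎
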